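{- Let $G=(V,E)$ be a simple, undirected graph on $n$ vertices with at least one triangle, let $A\in\{0,1\}^{n\times n}$ be its symmetric adjacency matrix, let $T=A^2\circ A$ be its graph triangle matrix, and let $\check T$ be the binary form of $T$. Then the vector $\mathbf r_{TC}=(TC(v))_{v\in V}$ of the triangle centralities of all vertices is given by $$\mathbf r_{TC}=\frac{\left(3A-2\check T+I\right)T\mathbf 1}{\mathbf 1^{\mathsf T}T\mathbf 1}.$$
   Context: $\circ$ is the Hadamard (entrywise) product; $\check T$ is the $0/1$ matrix obtained from $T$ by replacing each non-zero entry by $1$; $I$ is the $n\times n$ identity matrix and $\mathbf 1$ is the all-ones vector. For $v\in V$, $N(v)=\{u\mid (u,v)\in E\}$. A triangle is a complete subgraph on three vertices; $\triangle(v)$ is the number of triangles of $G$ containing $v$, and $\triangle(G)$ is the total number of triangles in $G$. The triangle neighborhood of $v$ is $N_\triangle(v)=\{u\in N(v)\mid N(u)\cap N(v)\neq\varnothing\}$, and $N_\triangle[v]=\{v\}\cup N_\triangle(v)$. The triangle centrality of $v$ is $$TC(v)=\frac{\frac13\sum_{u\in N_\triangle[v]}\triangle(u)+\sum_{w\in N(v)\setminus N_\triangle(v)}\triangle(w)}{\triangle(G)}.$$ -}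

module Defs where

open import Data.Bool.Base using (if_then_else_)
open import Data.Fin.Base using (Fin)
import Data.Fin.Properties as Fin
open import Data.Fin.Subset
  using (Subset; inside; outside; _∈_; ⁅_⁆; _∩_; _∪_; _─_; ∣_∣)
open import Data.Fin.Subset.Properties using (_∈?_; nonempty?)
open import Data.Integer.Base using (+_)
open import Data.List.Base using (List; []; _∷_; _++_; map; length; filter)
open import Data.Nat.Base as ℕ using (ℕ; zero; suc)
import Data.Nat.Properties as ℕ
open import Data.Product.Base using (_×_)
open import Data.Rational.Base
  using (ℚ; NonZero; 0ℚ; 1ℚ; _+_; _-_; _*_; _/_; _÷_; +-0-rawMonoid)
import Data.Rational.Properties as ℚ
open import Algebra.Definitions.RawMonoid +-0-rawMonoid using (sum)
open import Data.Vec.Base as Vec using ()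
open import Data.Vec.Functional using (Vector)
open import Relation.Binary.Core using (Rel)
open import Relation.Binary.Definitions using (Decidable; Symmetric; Irreflexive)
open import Relation.Binary.PropositionalEquality.Core using (_≡_; _≢_)
open import Relation.Nullary.Decidable.Core using (does; _×-dec_; _→-dec_; ¬?)
import Relation.Unary as U
open import Level using (0ℓ)

private
  variable
    l m n : ℕ

fromℕ : ℕ → ℚ
fromℕ k = + k / 1

Matrix : ℕ → ℕ → Set
Matrix m n = Vector (Vector ℚ n) m

infixl 7 _*ᴹ_ _*ᵛ_ _⊙_ _∙_
infixr 8 _•_
infixl 6 _+ᴹ_ _-ᴹ_

_+ᴹ_ : Matrix m n → Matrix m n → Matrix m n
(M +ᴹ N) i j = M i j + N i j

_-ᴹ_ : Matrix m n → Matrix m n → Matrix m n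
(M -ᴹ N) i j = M i j - N i j

_•_ : ℚ → Matrix m n → Matrix m n
(c • M) i j = c * M i j

_*ᴹ_ : Matrix l m → Matrix m n → Matrix l n
(M *ᴹ N) i k = sum (λ j → M i j * N j k)

_*ᵛ_ : Matrix m n → Vector ℚ n → Vector ℚ m
(M *ᵛ x) i = sum (λ j → M i j * x j)

-- x ∙ y is the scalar xᵀy.
_∙_ : Vector ℚ n → Vector ℚ n → ℚ
x ∙ y = sum (λ i → x i * y i)

_⊙_ : Matrix m n → Matrix m n → Matrix m n
(M ⊙ N) i j = M i j * N i j

infixl 7 _÷ᵛ_

_÷ᵛ_ : Vector ℚ n → (d : ℚ) → .{{_ : NonZero d}} → Vector ℚ n
(x ÷ᵛ d) i = x i ÷ d

binary : Matrix m n → Matrix m n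
binary M i j = if does (M i j ℚ.≟ 0ℚ) then 0ℚ else 1ℚ

I : Matrix n n
I i j = if does (i Fin.≟ j) then 1ℚ else 0ℚ

𝟏 : Vector ℚ n
𝟏 _ = 1ℚ

-- Every subset occurs exactly once, so lengths of filtered lists count subsets.
subsets : ∀ n → List (Subset n)
subsets zero    = Vec.[] ∷ []
subsets (suc n) = map (outside Vec.∷_) (subsets n) ++ map (inside Vec.∷_) (subsets n)

comprehension : {P : U.Pred (Fin n) 0ℓ} → U.Decidable P → Subset n
comprehension P? = Vec.tabulate (λ v → does (P? v))

sumOver : Subset n → (Fin n → ℚ) → ℚ
sumOver S f = sum (λ v → if does (v ∈? S) then f v else 0ℚ)

syntax sumOver S (λ v → e) = ∑[ v ∈ S ] e

record Graph (n : ℕ) : Set₁ where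
  field
    Adj    : Rel (Fin n) 0ℓ
    adj?   : Decidable Adj
    symm   : Symmetric Adj
    irrefl : Irreflexive _≡_ Adj

module _ (G : Graph n) where
  open Graph G

  N : Fin n → Subset n
  N v = comprehension (λ u → adj? v u)

  -- A complete subgraph is determined by its set of vertices.
  IsTriangle : Subset n → Set
  IsTriangle S = ∣ S ∣ ≡ 3 × (∀ u v → u ∈ S → v ∈ S → u ≢ v → Adj u v)

  isTriangle? : U.Decidable IsTriangle
  isTriangle? S = (∣ S ∣ ℕ.≟ 3) ×-dec
    Fin.all? λ u → Fin.all? λ v →
      (u ∈? S) →-dec ((v ∈? S) →-dec (¬? (u Fin.≟ v) →-dec adj? u v))

  △-total : ℕ
  △-total = length (filter isTriangle? (subsets n))

  △ : Fin n → ℕ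
  △ v = length (filter (λ S → isTriangle? S ×-dec (v ∈? S)) (subsets n))

  N△ : Fin n → Subset n
  N△ v = comprehension (λ u → (u ∈? N v) ×-dec nonempty? (N u ∩ N v))

  N△[_] : Fin n → Subset n
  N△[ v ] = ⁅ v ⁆ ∪ N△ v

  TC : .{{_ : ℕ.NonZero △-total}} → Vector ℚ n
  TC v = _÷_
    ( (+ 1 / 3) * (∑[ u ∈ N△[ v ] ] fromℕ (△ u))
    + (∑[ w ∈ N v ─ N△ v ] fromℕ (△ w)) )
    (fromℕ △-total)
    {{ℚ.pos⇒nonZero (fromℕ △-total) {{ℚ.normalize-pos △-total 1}}}}

  A : Matrix n n
  A u v = if does (adj? u v) then 1ℚ else 0ℚ

  T : Matrix n n
  T = (A *ᴹ A) ⊙ A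

  Ť : Matrix n n
  Ť = binary T

{-# OPTIONS --safe #-}

-- The product A v j · A j u · A v u is the number of triangles S with v ∈ S,
-- u ∈ S - v and j ∈ S - v - u, because ⁅ v ⁆ ∪ ⁅ u ⁆ ∪ ⁅ j ⁆ is the only candidate
-- for S.  Exchanging the sums over u, j and S, every triangle through v is counted
-- 2 · 1 times, so T 𝟏 = 2 △; counting incidences once more, 𝟏 ∙ T 𝟏 = 6 △(G).
-- Since Ť is the indicator of N△, three times the numerator of TC has coefficients
-- 3 A - 2 Ť + I.
module Submission where

open import Defs
open import Data.Nat.Base as ℕ using (ℕ)
open import Data.Product.Base using (Σ-syntax)
open import Data.Rational.Base using (NonZero)
open import Relation.Binary.PropositionalEquality using (_≗_)

open import Algebra.Bundles using (CommutativeRing)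
open import Data.Bool.Base using (true; false; if_then_else_)
import Data.Bool.Properties as Bool
open import Data.Empty using (⊥-elim)
open import Data.Fin.Base using (Fin; zero; suc)
import Data.Fin.Properties as Fin
open import Data.Fin.Subset
  using (Subset; inside; outside; _∈_; _∉_; _⊆_; ⁅_⁆; _∪_; _∩_; _─_; _-_; ∣_∣; Nonempty; Empty)
open import Data.Fin.Subset.Properties
import Data.Integer.Base as ℤ
import Data.Integer.Properties as ℤ
open import Data.List.Base using (List; []; _∷_; _++_; map; length; filter)
open import Data.Nat.Base using (zero; suc)
import Data.Nat.Coprimality as Coprime
import Data.Nat.Properties as ℕ
open import Data.Product.Base using (∃; _×_; _,_; proj₁)
open import Data.Rational.Base as ℚ
  using (ℚ; mkℚ; 0ℚ; 1ℚ; _+_; _*_; _/_; _÷_; 1/_; Positive)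
import Data.Rational.Properties as ℚ
open import Data.Rational.Solver using (module +-*-Solver)
open import Data.Sum.Base using (_⊎_; inj₁; inj₂; [_,_]′)
import Data.Vec.Base as Vec
open import Data.Vec.Functional using (Vector)
import Data.Vec.Properties as Vec
open import Function.Base using (_∘_)
open import Function.Bundles using (_⇔_; mk⇔; module Equivalence)
open import Level using (Level)
open import Relation.Binary.PropositionalEquality
  using (_≡_; _≢_; refl; sym; trans; cong; cong₂; subst; module ≡-Reasoning)
open import Relation.Nullary.Decidable.Core using (Dec; yes; no; does; _×-dec_; ¬?)
open import Relation.Nullary.Decidable using (does-⇔; dec-true)
open import Relation.Nullary.Negation using (¬_; contradiction)
import Relation.Unary as U

open import Algebra.Properties.Semiring.Sum (CommutativeRing.semiring ℚ.+-*-commutativeRing)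
  using (sum; sum-cong-≗; sum-replicate-zero; ∑-distrib-+; ∑-comm; *-distribˡ-sum; *-distribʳ-sum)

private
  variable
    p ℓ : Level
    l m n : ℕ
    P Q : Set p
    X Y : Set ℓ

open ≡-Reasoning

-- Arithmetic of rationals

fromℕ-suc : ∀ k → fromℕ (suc k) ≡ 1ℚ + fromℕ k
fromℕ-suc k = sym (begin
  -- For a variable `k`, `fromℕ k` is stuck on its gcd normalisation; an explicit `mkℚ` lets the
  -- addition unfold.
  1ℚ + fromℕ k                         ≡⟨ cong (1ℚ +_) (ℚ.normalize-coprime coprime) ⟩
  1ℚ + mkℚ (ℤ.+ k) 0 coprime             ≡⟨⟩
  (ℤ.+ 1 ℤ.* ℤ.+ 1 ℤ.+ ℤ.+ k ℤ.* ℤ.+ 1) / 1    ≡⟨ cong (λ i → (ℤ.+ 1 ℤ.+ i) / 1) (ℤ.*-identityʳ (ℤ.+ k)) ⟩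
  fromℕ (suc k)                        ∎)
  where
  coprime : Coprime.Coprime k 1
  coprime = Coprime.sym (Coprime.1-coprimeTo k)

x÷y≡z÷w : ∀ x y z w .{{_ : NonZero y}} .{{_ : NonZero w}} → x * w ≡ z * y → x ÷ y ≡ z ÷ w
x÷y≡z÷w x y z w xw≡zy = begin
  x * 1/ y                    ≡⟨ ℚ.*-identityʳ _ ⟨
  x * 1/ y * 1ℚ               ≡⟨ cong (x * 1/ y *_) (ℚ.*-inverseʳ w) ⟨
  x * 1/ y * (w * 1/ w)       ≡⟨ solve 4 (λ a b c d → a :* b :* (c :* d) := a :* c :* (b :* d)) refl x (1/ y) w (1/ w) ⟩
  x * w * (1/ y * 1/ w)       ≡⟨ cong (_* (1/ y * 1/ w)) xw≡zy ⟩
  z * y * (1/ y * 1/ w)       ≡⟨ solve 4 (λ a b c d → a :* b :* (c :* d) := a :* d :* (b :* c)) refl z y (1/ y) (1/ w) ⟩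
  z * 1/ w * (y * 1/ y)       ≡⟨ cong (z * 1/ w *_) (ℚ.*-inverseʳ y) ⟩
  z * 1/ w * 1ℚ               ≡⟨ ℚ.*-identityʳ _ ⟩
  z * 1/ w                    ∎
  where open +-*-Solver using (solve; _:=_; _:*_)

-- Indicators

⟦_⟧ : Dec P → ℚ
⟦ P? ⟧ = if does P? then 1ℚ else 0ℚ

⟦⟧-⇔ : P ⇔ Q → (P? : Dec P) (Q? : Dec Q) → ⟦ P? ⟧ ≡ ⟦ Q? ⟧
⟦⟧-⇔ P⇔Q P? Q? = cong (if_then 1ℚ else 0ℚ) (does-⇔ P⇔Q P? Q?)

⟦⟧-× : (P? : Dec P) (Q? : Dec Q) → ⟦ P? ×-dec Q? ⟧ ≡ ⟦ P? ⟧ * ⟦ Q? ⟧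
⟦⟧-× (yes _) (yes _) = refl
⟦⟧-× (yes _) (no _)  = refl
⟦⟧-× (no _)  Q?      = sym (ℚ.*-zeroˡ ⟦ Q? ⟧)

-- `R` is tied to the disjoint alternatives only by implications, so that one case split serves both
-- membership in a union and the splitting of a set along a subset.
⟦⟧-⊎ : ∀ {R : Set ℓ} → (R → P ⊎ Q) → (P → R) → (Q → R) → ¬ (P × Q) →
       (R? : Dec R) (P? : Dec P) (Q? : Dec Q) → ⟦ R? ⟧ ≡ ⟦ P? ⟧ + ⟦ Q? ⟧
⟦⟧-⊎ R→P⊎Q P→R Q→R disj _       (yes a) (yes b) = contradiction (a , b) disj
⟦⟧-⊎ R→P⊎Q P→R Q→R disj (yes _) (yes _) (no _)  = refl
⟦⟧-⊎ R→P⊎Q P→R Q→R disj (no ¬r) (yes a) (no _)  = contradiction (P→R a) ¬r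
⟦⟧-⊎ R→P⊎Q P→R Q→R disj (yes _) (no _)  (yes _) = refl
⟦⟧-⊎ R→P⊎Q P→R Q→R disj (no ¬r) (no _)  (yes b) = contradiction (Q→R b) ¬r
⟦⟧-⊎ R→P⊎Q P→R Q→R disj (yes r) (no ¬a) (no ¬b) = ⊥-elim ([ ¬a , ¬b ]′ (R→P⊎Q r))
⟦⟧-⊎ R→P⊎Q P→R Q→R disj (no _)  (no _)  (no _)  = refl

-- Under an indicator factor `P` may be assumed: where it fails, both products vanish. This brings
-- in facts such as `∣ S ∣ ≡ 3` that hold for triangles only.
⟦⟧*-cong : (P? : Dec P) {x y : ℚ} → (P → x ≡ y) → ⟦ P? ⟧ * x ≡ ⟦ P? ⟧ * y
⟦⟧*-cong (yes a) x≡y = cong (1ℚ *_) (x≡y a)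
⟦⟧*-cong (no _) {x} {y} _ = trans (ℚ.*-zeroˡ x) (sym (ℚ.*-zeroˡ y))

if≡⟦⟧* : (P? : Dec P) (x : ℚ) → (if does P? then x else 0ℚ) ≡ ⟦ P? ⟧ * x
if≡⟦⟧* (yes _) x = sym (ℚ.*-identityˡ x)
if≡⟦⟧* (no _)  x = sym (ℚ.*-zeroˡ x)

⟦⟧-nonNeg : (P? : Dec P) → 0ℚ ℚ.≤ ⟦ P? ⟧
⟦⟧-nonNeg (yes _) = ℚ.nonNegative⁻¹ 1ℚ
⟦⟧-nonNeg (no _)  = ℚ.≤-refl

⟦⟧≢0 : (P? : Dec P) → P → ⟦ P? ⟧ ≢ 0ℚ
⟦⟧≢0 (yes _) _ ()
⟦⟧≢0 (no ¬a) a = contradiction a ¬a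

⟦⟧≡0 : (P? : Dec P) → ¬ P → ⟦ P? ⟧ ≡ 0ℚ
⟦⟧≡0 (yes a) ¬a = contradiction a ¬a
⟦⟧≡0 (no _)  _  = refl

-- Sums over lists

sumˡ : List X → (X → ℚ) → ℚ
sumˡ []       f = 0ℚ
sumˡ (x ∷ xs) f = f x + sumˡ xs f

sumˡ-cong : ∀ (xs : List X) {f g} → f ≗ g → sumˡ xs f ≡ sumˡ xs g
sumˡ-cong []       f≗g = refl
sumˡ-cong (x ∷ xs) f≗g = cong₂ _+_ (f≗g x) (sumˡ-cong xs f≗g)

sumˡ-map : ∀ (g : X → Y) xs f → sumˡ (map g xs) f ≡ sumˡ xs (f ∘ g)
sumˡ-map g []       f = refl
sumˡ-map g (x ∷ xs) f = cong (f (g x) +_) (sumˡ-map g xs f)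

sumˡ-++ : ∀ (xs ys : List X) f → sumˡ (xs ++ ys) f ≡ sumˡ xs f + sumˡ ys f
sumˡ-++ []       ys f = sym (ℚ.+-identityˡ _)
sumˡ-++ (x ∷ xs) ys f = trans (cong (f x +_) (sumˡ-++ xs ys f)) (sym (ℚ.+-assoc (f x) _ _))

*-distribˡ-sumˡ : ∀ c (xs : List X) f → c * sumˡ xs f ≡ sumˡ xs (λ x → c * f x)
*-distribˡ-sumˡ c []       f = ℚ.*-zeroʳ c
*-distribˡ-sumˡ c (x ∷ xs) f =
  trans (ℚ.*-distribˡ-+ c (f x) _) (cong (c * f x +_) (*-distribˡ-sumˡ c xs f))

sum-sumˡ-comm : ∀ (xs : List X) (f : Fin n → X → ℚ) →
                sum (λ i → sumˡ xs (f i)) ≡ sumˡ xs (λ x → sum (λ i → f i x))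
sum-sumˡ-comm {n = n} []       f = sum-replicate-zero n
sum-sumˡ-comm         (x ∷ xs) f =
  trans (∑-distrib-+ (λ i → f i x) _) (cong (sum (λ i → f i x) +_) (sum-sumˡ-comm xs f))

-- Turns the counts `△` and `△-total` into sums of indicators, whose order of summation can be
-- exchanged.
fromℕ-length-filter : {P : U.Pred X ℓ} (P? : U.Decidable P) (xs : List X) →
                      fromℕ (length (filter P? xs)) ≡ sumˡ xs (λ x → ⟦ P? x ⟧)
fromℕ-length-filter P? []       = refl
fromℕ-length-filter P? (x ∷ xs) with does (P? x)
... | true  = trans (fromℕ-suc (length (filter P? xs))) (cong (1ℚ +_) (fromℕ-length-filter P? xs))
... | false = trans (fromℕ-length-filter P? xs) (sym (ℚ.+-identityˡ _))

-- Subsets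

_≟ˢ_ : (p q : Subset n) → Dec (p ≡ q)
_≟ˢ_ = Vec.≡-dec Bool._≟_

-- By induction on `q`: its first bit selects one of the two halves of the list, and within that
-- half its tail occurs once.
sumˡ-subsets-≡ : (q : Subset n) → sumˡ (subsets n) (λ p → ⟦ p ≟ˢ q ⟧) ≡ 1ℚ
sumˡ-subsets-≡ Vec.[] = refl
sumˡ-subsets-≡ {suc n} (s Vec.∷ q) = begin
  sumˡ (subsets (suc n)) eq                                ≡⟨ sumˡ-++ (map (outside Vec.∷_) ps) _ eq ⟩
  sumˡ (map (outside Vec.∷_) ps) eq + sumˡ (map (inside Vec.∷_) ps) eq
                                                           ≡⟨ cong₂ _+_ (half outside) (half inside) ⟩
  ⟦ outside Bool.≟ s ⟧ + ⟦ inside Bool.≟ s ⟧               ≡⟨ one-side s ⟩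
  1ℚ                                                       ∎
  where
  ps = subsets n
  eq = λ p → ⟦ p ≟ˢ (s Vec.∷ q) ⟧

  ∷-≟ : ∀ b p → ⟦ (b Vec.∷ p) ≟ˢ (s Vec.∷ q) ⟧ ≡ ⟦ b Bool.≟ s ⟧ * ⟦ p ≟ˢ q ⟧
  ∷-≟ b p = trans
    (⟦⟧-⇔ (mk⇔ Vec.∷-injective λ { (refl , refl) → refl })
      ((b Vec.∷ p) ≟ˢ (s Vec.∷ q)) (b Bool.≟ s ×-dec p ≟ˢ q))
    (⟦⟧-× (b Bool.≟ s) (p ≟ˢ q))

  half : ∀ b → sumˡ (map (b Vec.∷_) ps) eq ≡ ⟦ b Bool.≟ s ⟧
  half b = begin
    sumˡ (map (b Vec.∷_) ps) eq                       ≡⟨ sumˡ-map (b Vec.∷_) ps eq ⟩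
    sumˡ ps (λ p → eq (b Vec.∷ p))                    ≡⟨ sumˡ-cong ps (∷-≟ b) ⟩
    sumˡ ps (λ p → ⟦ b Bool.≟ s ⟧ * ⟦ p ≟ˢ q ⟧)       ≡⟨ *-distribˡ-sumˡ ⟦ b Bool.≟ s ⟧ ps _ ⟨
    ⟦ b Bool.≟ s ⟧ * sumˡ ps (λ p → ⟦ p ≟ˢ q ⟧)       ≡⟨ cong (⟦ b Bool.≟ s ⟧ *_) (sumˡ-subsets-≡ q) ⟩
    ⟦ b Bool.≟ s ⟧ * 1ℚ                               ≡⟨ ℚ.*-identityʳ _ ⟩
    ⟦ b Bool.≟ s ⟧                                    ∎

  one-side : ∀ b → ⟦ outside Bool.≟ b ⟧ + ⟦ inside Bool.≟ b ⟧ ≡ 1ℚ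
  one-side outside = refl
  one-side inside  = refl

fromℕ-∣∣ : (p : Subset n) → fromℕ ∣ p ∣ ≡ sum (λ x → ⟦ x ∈? p ⟧)
fromℕ-∣∣ Vec.[]            = refl
fromℕ-∣∣ (inside  Vec.∷ p) = trans (fromℕ-suc ∣ p ∣) (cong (1ℚ +_) (fromℕ-∣∣ p))
fromℕ-∣∣ (outside Vec.∷ p) = trans (fromℕ-∣∣ p) (sym (ℚ.+-identityˡ _))

x∈p⇒∣p∣≡1+∣p-x∣ : ∀ {x} {p : Subset n} → x ∈ p → ∣ p ∣ ≡ suc ∣ p - x ∣
-- Removing the head subtracts the empty set from the tail, hence `p─⊥≡p`.
x∈p⇒∣p∣≡1+∣p-x∣ {p = inside Vec.∷ p}  Vec.here        = cong (suc ∘ ∣_∣) (sym (p─⊥≡p p))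
x∈p⇒∣p∣≡1+∣p-x∣ {p = inside Vec.∷ p}  (Vec.there x∈p) = cong suc (x∈p⇒∣p∣≡1+∣p-x∣ x∈p)
x∈p⇒∣p∣≡1+∣p-x∣ {p = outside Vec.∷ p} (Vec.there x∈p) = x∈p⇒∣p∣≡1+∣p-x∣ x∈p

x∈q⇒x∉p─q : ∀ {x} (p q : Subset n) → x ∈ q → x ∉ p ─ q
x∈q⇒x∉p─q (_ Vec.∷ p) (_ Vec.∷ q) (Vec.there x∈q) (Vec.there x∈p─q) = x∈q⇒x∉p─q p q x∈q x∈p─q

x∈p-y⇒x∈p : ∀ {x y} {p : Subset n} → x ∈ p - y → x ∈ p
x∈p-y⇒x∈p {y = y} {p} = p─q⊆p p ⁅ y ⁆

x∈p-y⇒x≢y : ∀ {x y} {p : Subset n} → x ∈ p - y → x ≢ y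
x∈p-y⇒x≢y {x = x} {p = p} x∈p-x refl = x∈q⇒x∉p─q p ⁅ x ⁆ (x∈⁅x⁆ x) x∈p-x

⟦∈∪⟧ : ∀ (p q : Subset n) → Empty (p ∩ q) → ∀ x → ⟦ x ∈? p ∪ q ⟧ ≡ ⟦ x ∈? p ⟧ + ⟦ x ∈? q ⟧
⟦∈∪⟧ p q disj x = ⟦⟧-⊎ (x∈p∪q⁻ p q) (p⊆p∪q q) (q⊆p∪q p q) (λ x∈ → disj (x , x∈p∩q⁺ x∈))
  (x ∈? p ∪ q) (x ∈? p) (x ∈? q)

⟦∈─⟧ : ∀ {p q : Subset n} → q ⊆ p → ∀ x → ⟦ x ∈? p ⟧ ≡ ⟦ x ∈? p ─ q ⟧ + ⟦ x ∈? q ⟧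
⟦∈─⟧ {p = p} {q} q⊆p x =
  ⟦⟧-⊎ split (p─q⊆p p q) q⊆p (λ (x∈p─q , x∈q) → x∈q⇒x∉p─q p q x∈q x∈p─q) (x ∈? p) (x ∈? p ─ q) (x ∈? q)
  where
  split : x ∈ p → x ∈ p ─ q ⊎ x ∈ q
  split x∈p with x ∈? q
  ... | yes x∈q = inj₂ x∈q
  ... | no  x∉q = inj₁ (x∈p∧x∉q⇒x∈p─q x∈p x∉q)

⟦∈⁅⁆⟧ : ∀ (x y : Fin n) → ⟦ y ∈? ⁅ x ⁆ ⟧ ≡ I x y
⟦∈⁅⁆⟧ x y = ⟦⟧-⇔ (mk⇔ (sym ∘ x∈⁅y⁆⇒x≡y x) λ { refl → x∈⁅x⁆ x }) (y ∈? ⁅ x ⁆) (x Fin.≟ y)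

∈-comprehension : {P : U.Pred (Fin n) Level.zero} (P? : U.Decidable P) {x : Fin n} → x ∈ comprehension P? ⇔ P x
∈-comprehension P? {x} = mk⇔ to from
  where
  to : x ∈ comprehension P? → _
  to x∈ with P? x | trans (sym (Vec.lookup∘tabulate (does ∘ P?) x)) (Vec.[]=⇒lookup x∈)
  ... | yes Px | _  = Px
  ... | no _   | ()
  from : _ → x ∈ comprehension P?
  from Px = Vec.lookup⇒[]= x _ (trans (Vec.lookup∘tabulate (does ∘ P?) x) (dec-true (P? x) Px))

-- Once `x` is chosen from `p`, the number of choices for `y` does not depend on `x`. For an empty
-- `p` the truncated `pred` is harmless, since the other factor is zero.
sum-ordered-pairs : (p : Subset n) →
            sum (λ x → sum (λ y → ⟦ x ∈? p ⟧ * ⟦ y ∈? p - x ⟧)) ≡ fromℕ ∣ p ∣ * fromℕ (ℕ.pred ∣ p ∣)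
sum-ordered-pairs p = begin
  sum (λ x → sum (λ y → ⟦ x ∈? p ⟧ * ⟦ y ∈? p - x ⟧))
    ≡⟨ sum-cong-≗ (λ x → trans (sym (*-distribˡ-sum ⟦ x ∈? p ⟧ (λ y → ⟦ y ∈? p - x ⟧)))
                               (cong (⟦ x ∈? p ⟧ *_) (sym (fromℕ-∣∣ (p - x))))) ⟩
  sum (λ x → ⟦ x ∈? p ⟧ * fromℕ ∣ p - x ∣)
    ≡⟨ sum-cong-≗ (λ x → ⟦⟧*-cong (x ∈? p) (λ x∈p → cong (fromℕ ∘ ℕ.pred) (sym (x∈p⇒∣p∣≡1+∣p-x∣ x∈p)))) ⟩
  sum (λ x → ⟦ x ∈? p ⟧ * fromℕ (ℕ.pred ∣ p ∣))
    ≡⟨ *-distribʳ-sum (fromℕ (ℕ.pred ∣ p ∣)) (λ x → ⟦ x ∈? p ⟧) ⟨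
  sum (λ x → ⟦ x ∈? p ⟧) * fromℕ (ℕ.pred ∣ p ∣)
    ≡⟨ cong (_* fromℕ (ℕ.pred ∣ p ∣)) (fromℕ-∣∣ p) ⟨
  fromℕ ∣ p ∣ * fromℕ (ℕ.pred ∣ p ∣) ∎

-- Sums and matrices

sum-nonNeg : (f : Vector ℚ n) → (∀ i → 0ℚ ℚ.≤ f i) → 0ℚ ℚ.≤ sum f
sum-nonNeg {zero}  f 0≤f = ℚ.≤-refl
sum-nonNeg {suc n} f 0≤f = ℚ.+-mono-≤ (0≤f zero) (sum-nonNeg (f ∘ suc) (0≤f ∘ suc))

≤-sum : (f : Vector ℚ n) → (∀ i → 0ℚ ℚ.≤ f i) → ∀ i → f i ℚ.≤ sum f
≤-sum f 0≤f zero    = subst (ℚ._≤ sum f) (ℚ.+-identityʳ _)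
  (ℚ.+-monoʳ-≤ (f zero) (sum-nonNeg (f ∘ suc) (0≤f ∘ suc)))
≤-sum f 0≤f (suc i) = subst (ℚ._≤ sum f) (ℚ.+-identityˡ _)
  (ℚ.+-mono-≤ (0≤f zero) (≤-sum (f ∘ suc) (0≤f ∘ suc) i))

-- Indicators are nonnegative and cannot cancel: each one is bounded by the sum, so a zero sum
-- forces all of them to be zero.
sum-⟦⟧≢0⇔∃ : {P : U.Pred (Fin n) ℓ} (P? : U.Decidable P) → sum (λ i → ⟦ P? i ⟧) ≢ 0ℚ ⇔ ∃ P
sum-⟦⟧≢0⇔∃ {n = n} {P = P} P? = mk⇔ to from
  where
  to : sum (λ i → ⟦ P? i ⟧) ≢ 0ℚ → ∃ P
  to sum≢0 with Fin.any? P?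
  ... | yes ∃P = ∃P
  ... | no ∄P  = contradiction
    (trans (sum-cong-≗ (λ i → ⟦⟧≡0 (P? i) (∄P ∘ (i ,_)))) (sum-replicate-zero n)) sum≢0

  from : ∃ P → sum (λ i → ⟦ P? i ⟧) ≢ 0ℚ
  from (i , Pi) sum≡0 = ⟦⟧≢0 (P? i) Pi (ℚ.≤-antisym
    (subst (⟦ P? i ⟧ ℚ.≤_) sum≡0 (≤-sum (λ j → ⟦ P? j ⟧) (⟦⟧-nonNeg ∘ P?) i))
    (⟦⟧-nonNeg (P? i)))

-- Allows `T 𝟏` to be evaluated before the coefficient matrix is applied to it.
*ᴹ-*ᵛ-assoc : (M : Matrix l m) (K : Matrix m n) (x : Vector ℚ n) → M *ᴹ K *ᵛ x ≗ M *ᵛ (K *ᵛ x)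
*ᴹ-*ᵛ-assoc M K x i = begin
  sum (λ k → sum (λ j → M i j * K j k) * x k)
    ≡⟨ sum-cong-≗ (λ k → *-distribʳ-sum (x k) (λ j → M i j * K j k)) ⟩
  sum (λ k → sum (λ j → M i j * K j k * x k))
    ≡⟨ ∑-comm (λ k j → M i j * K j k * x k) ⟩
  sum (λ j → sum (λ k → M i j * K j k * x k))
    ≡⟨ sum-cong-≗ (λ j → sum-cong-≗ (λ k → ℚ.*-assoc (M i j) (K j k) (x k))) ⟩
  sum (λ j → sum (λ k → M i j * (K j k * x k)))
    ≡⟨ sum-cong-≗ (λ j → *-distribˡ-sum (M i j) (λ k → K j k * x k)) ⟨
  sum (λ j → M i j * sum (λ k → K j k * x k)) ∎

-- Triangles

module _ {n} (G : Graph n) where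
  open Graph G

  Adj⇒≢ : ∀ {u v} → Adj u v → u ≢ v
  Adj⇒≢ uv u≡v = irrefl u≡v uv

  -- The successive removals express that `v`, `u` and `j` are distinct, in the form that
  -- `sum-ordered-pairs` counts for the set `S - v`.
  OrderedTriangle : (v u j : Fin n) → Subset n → Set
  OrderedTriangle v u j S = (IsTriangle G S × v ∈ S) × (u ∈ S - v × j ∈ S - v - u)

  -- From left to right, completeness of `S` gives the adjacencies, and three distinct elements
  -- exhaust a set of size 3. From right to left, irreflexivity makes the three vertices distinct.
  -- The adjacencies are listed in the order of the factors of a summand of `T`.
  orderedTriangle⇔ : ∀ {v u j S} →
    OrderedTriangle v u j S ⇔ (((Adj v j × Adj j u) × Adj v u) × S ≡ ⁅ v ⁆ ∪ ⁅ u ⁆ ∪ ⁅ j ⁆)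
  orderedTriangle⇔ {v} {u} {j} {S} = mk⇔ to from
    where
    v∈S₀ : v ∈ ⁅ v ⁆ ∪ ⁅ u ⁆ ∪ ⁅ j ⁆
    v∈S₀ = p⊆p∪q _ (x∈⁅x⁆ v)
    u∈S₀ : u ∈ ⁅ v ⁆ ∪ ⁅ u ⁆ ∪ ⁅ j ⁆
    u∈S₀ = q⊆p∪q ⁅ v ⁆ _ (p⊆p∪q ⁅ j ⁆ (x∈⁅x⁆ u))
    j∈S₀ : j ∈ ⁅ v ⁆ ∪ ⁅ u ⁆ ∪ ⁅ j ⁆
    j∈S₀ = q⊆p∪q ⁅ v ⁆ _ (q⊆p∪q ⁅ u ⁆ ⁅ j ⁆ (x∈⁅x⁆ j))

    ∈S₀⁻ : ∀ {x} → x ∈ ⁅ v ⁆ ∪ ⁅ u ⁆ ∪ ⁅ j ⁆ → x ≡ v ⊎ x ≡ u ⊎ x ≡ j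
    ∈S₀⁻ x∈ with x∈p∪q⁻ ⁅ v ⁆ _ x∈
    ... | inj₁ x∈v = inj₁ (x∈⁅y⁆⇒x≡y v x∈v)
    ... | inj₂ x∈uj with x∈p∪q⁻ ⁅ u ⁆ ⁅ j ⁆ x∈uj
    ...   | inj₁ x∈u = inj₂ (inj₁ (x∈⁅y⁆⇒x≡y u x∈u))
    ...   | inj₂ x∈j = inj₂ (inj₂ (x∈⁅y⁆⇒x≡y j x∈j))

    ∣S∣ : v ∈ S → u ∈ S - v → j ∈ S - v - u → ∣ S ∣ ≡ suc (suc (suc ∣ S - v - u - j ∣))
    ∣S∣ v∈ u∈ j∈ = trans (x∈p⇒∣p∣≡1+∣p-x∣ v∈) (cong suc
                  (trans (x∈p⇒∣p∣≡1+∣p-x∣ u∈) (cong suc (x∈p⇒∣p∣≡1+∣p-x∣ j∈))))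

    to : OrderedTriangle v u j S → _
    to (((∣S∣≡3 , adj) , v∈) , u∈ , j∈) =
      ((adj v j v∈ j∈S (j≢v ∘ sym) , adj j u j∈S u∈S j≢u) , adj v u v∈ u∈S (u≢v ∘ sym)) ,
      ⊆-antisym S⊆S₀ S₀⊆S
      where
      u∈S : u ∈ S
      u∈S = x∈p-y⇒x∈p u∈
      j∈S : j ∈ S
      j∈S = x∈p-y⇒x∈p (x∈p-y⇒x∈p j∈)
      u≢v : u ≢ v
      u≢v = x∈p-y⇒x≢y u∈
      j≢u : j ≢ u
      j≢u = x∈p-y⇒x≢y j∈
      j≢v : j ≢ v
      j≢v = x∈p-y⇒x≢y (x∈p-y⇒x∈p j∈)

      S⊆S₀ : S ⊆ ⁅ v ⁆ ∪ ⁅ u ⁆ ∪ ⁅ j ⁆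
      S⊆S₀ {x} x∈S with x Fin.≟ v | x Fin.≟ u | x Fin.≟ j
      ... | yes refl | _        | _        = v∈S₀
      ... | no _     | yes refl | _        = u∈S₀
      ... | no _     | no _     | yes refl = j∈S₀
      -- A fourth element would survive the three removals and make `∣ S ∣` at least 4.
      ... | no x≢v   | no x≢u   | no x≢j   = contradiction
        (trans (cong (3 ℕ.+_) (sym (x∈p⇒∣p∣≡1+∣p-x∣ x∈))) (trans (sym (∣S∣ v∈ u∈ j∈)) ∣S∣≡3))
        λ ()
        where
        x∈ : x ∈ S - v - u - j
        x∈ = x∈p∧x≢y⇒x∈p-y (x∈p∧x≢y⇒x∈p-y (x∈p∧x≢y⇒x∈p-y x∈S x≢v) x≢u) x≢j

      S₀⊆S : ⁅ v ⁆ ∪ ⁅ u ⁆ ∪ ⁅ j ⁆ ⊆ S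
      S₀⊆S x∈ with ∈S₀⁻ x∈
      ... | inj₁ refl        = v∈
      ... | inj₂ (inj₁ refl) = u∈S
      ... | inj₂ (inj₂ refl) = j∈S

    from : _ → OrderedTriangle v u j S
    from (((vj , ju) , vu) , refl) = ((∣S∣≡3 , adj) , v∈S₀) , u∈ , j∈
      where
      u∈ : u ∈ S - v
      u∈ = x∈p∧x≢y⇒x∈p-y u∈S₀ (Adj⇒≢ (symm vu))
      j∈ : j ∈ S - v - u
      j∈ = x∈p∧x≢y⇒x∈p-y (x∈p∧x≢y⇒x∈p-y j∈S₀ (Adj⇒≢ (symm vj))) (Adj⇒≢ ju)

      -- This gives the upper bound on `∣ S ∣`: an element left over would equal one of `v`, `u`,
      -- `j`, yet each of them has been removed.
      empty : Empty (S - v - u - j)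
      empty (x , x∈) with ∈S₀⁻ (x∈p-y⇒x∈p (x∈p-y⇒x∈p (x∈p-y⇒x∈p x∈)))
      ... | inj₁ x≡v        = x∈p-y⇒x≢y (x∈p-y⇒x∈p (x∈p-y⇒x∈p x∈)) x≡v
      ... | inj₂ (inj₁ x≡u) = x∈p-y⇒x≢y (x∈p-y⇒x∈p x∈) x≡u
      ... | inj₂ (inj₂ x≡j) = x∈p-y⇒x≢y x∈ x≡j

      ∣S∣≡3 : ∣ S ∣ ≡ 3
      ∣S∣≡3 = trans (∣S∣ v∈S₀ u∈ j∈)
        (cong (3 ℕ.+_) (trans (cong ∣_∣ (Empty-unique empty)) (∣⊥∣≡0 n)))

      adj : ∀ x y → x ∈ S → y ∈ S → x ≢ y → Adj x y
      adj x y x∈ y∈ x≢y with ∈S₀⁻ x∈ | ∈S₀⁻ y∈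
      ... | inj₁ refl        | inj₁ refl        = contradiction refl x≢y
      ... | inj₁ refl        | inj₂ (inj₁ refl) = vu
      ... | inj₁ refl        | inj₂ (inj₂ refl) = vj
      ... | inj₂ (inj₁ refl) | inj₁ refl        = symm vu
      ... | inj₂ (inj₁ refl) | inj₂ (inj₁ refl) = contradiction refl x≢y
      ... | inj₂ (inj₁ refl) | inj₂ (inj₂ refl) = symm ju
      ... | inj₂ (inj₂ refl) | inj₁ refl        = symm vj
      ... | inj₂ (inj₂ refl) | inj₂ (inj₁ refl) = ju
      ... | inj₂ (inj₂ refl) | inj₂ (inj₂ refl) = contradiction refl x≢y

  -- Row sums of `T` and the total number of triangles

  △? : ∀ v S → Dec (IsTriangle G S × v ∈ S)
  △? v S = isTriangle? G S ×-dec (v ∈? S)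

  AAA≡⟦⟧ : ∀ v u j → A G v j * A G j u * A G v u ≡ ⟦ (adj? v j ×-dec adj? j u) ×-dec adj? v u ⟧
  AAA≡⟦⟧ v u j = sym (trans (⟦⟧-× (adj? v j ×-dec adj? j u) (adj? v u))
                            (cong (_* A G v u) (⟦⟧-× (adj? v j) (adj? j u))))

  -- The product is multiplied by 1, written as the sum over all `S` of the indicator of `S ≡ S₀`.
  -- This introduces the sum over `S` that is later exchanged with those over `u` and `j`.
  AAA≡sumˡ : ∀ v u j → A G v j * A G j u * A G v u ≡
    sumˡ (subsets n) (λ S → ⟦ △? v S ⟧ * (⟦ u ∈? S - v ⟧ * ⟦ j ∈? S - v - u ⟧))
  AAA≡sumˡ v u j = begin
    A G v j * A G j u * A G v u
      ≡⟨ AAA≡⟦⟧ v u j ⟩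
    ⟦ adj³? ⟧
      ≡⟨ ℚ.*-identityʳ _ ⟨
    ⟦ adj³? ⟧ * 1ℚ
      ≡⟨ cong (⟦ adj³? ⟧ *_) (sumˡ-subsets-≡ S₀) ⟨
    ⟦ adj³? ⟧ * sumˡ (subsets n) (λ S → ⟦ S ≟ˢ S₀ ⟧)
      ≡⟨ *-distribˡ-sumˡ ⟦ adj³? ⟧ (subsets n) _ ⟩
    sumˡ (subsets n) (λ S → ⟦ adj³? ⟧ * ⟦ S ≟ˢ S₀ ⟧)
      ≡⟨ sumˡ-cong (subsets n) term ⟩
    sumˡ (subsets n) (λ S → ⟦ △? v S ⟧ * (⟦ u ∈? S - v ⟧ * ⟦ j ∈? S - v - u ⟧)) ∎
    where
    S₀ = ⁅ v ⁆ ∪ ⁅ u ⁆ ∪ ⁅ j ⁆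
    adj³? = (adj? v j ×-dec adj? j u) ×-dec adj? v u
    term : ∀ S → ⟦ adj³? ⟧ * ⟦ S ≟ˢ S₀ ⟧ ≡ ⟦ △? v S ⟧ * (⟦ u ∈? S - v ⟧ * ⟦ j ∈? S - v - u ⟧)
    term S = begin
      ⟦ adj³? ⟧ * ⟦ S ≟ˢ S₀ ⟧
        ≡⟨ ⟦⟧-× adj³? (S ≟ˢ S₀) ⟨
      ⟦ adj³? ×-dec (S ≟ˢ S₀) ⟧
        ≡⟨ ⟦⟧-⇔ orderedTriangle⇔ (△? v S ×-dec (u ∈? S - v ×-dec j ∈? S - v - u)) (adj³? ×-dec (S ≟ˢ S₀)) ⟨
      ⟦ △? v S ×-dec (u ∈? S - v ×-dec j ∈? S - v - u) ⟧
        ≡⟨ ⟦⟧-× (△? v S) (u ∈? S - v ×-dec j ∈? S - v - u) ⟩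
      ⟦ △? v S ⟧ * ⟦ u ∈? S - v ×-dec j ∈? S - v - u ⟧
        ≡⟨ cong (⟦ △? v S ⟧ *_) (⟦⟧-× (u ∈? S - v) (j ∈? S - v - u)) ⟩
      ⟦ △? v S ⟧ * (⟦ u ∈? S - v ⟧ * ⟦ j ∈? S - v - u ⟧) ∎

  T𝟏≡2△ : ∀ v → (T G *ᵛ 𝟏) v ≡ fromℕ 2 * fromℕ (△ G v)
  T𝟏≡2△ v = begin
    sum (λ u → sum (λ j → A G v j * A G j u) * A G v u * 1ℚ)
      ≡⟨ sum-cong-≗ (λ u → trans (ℚ.*-identityʳ _) (trans (*-distribʳ-sum (A G v u) (λ j → A G v j * A G j u))
                           (sum-cong-≗ (AAA≡sumˡ v u)))) ⟩
    sum (λ u → sum (λ j → sumˡ (subsets n) (λ S → ⟦ △? v S ⟧ * pair S u j)))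
      -- The sum over `S` is moved outwards past `j` first, then past `u`.
      ≡⟨ sum-cong-≗ (λ u → sum-sumˡ-comm (subsets n) (λ j S → ⟦ △? v S ⟧ * pair S u j)) ⟩
    sum (λ u → sumˡ (subsets n) (λ S → sum (λ j → ⟦ △? v S ⟧ * pair S u j)))
      ≡⟨ sum-sumˡ-comm (subsets n) (λ u S → sum (λ j → ⟦ △? v S ⟧ * pair S u j)) ⟩
    sumˡ (subsets n) (λ S → sum (λ u → sum (λ j → ⟦ △? v S ⟧ * pair S u j)))
      ≡⟨ sumˡ-cong (subsets n) term ⟩
    sumˡ (subsets n) (λ S → fromℕ 2 * ⟦ △? v S ⟧)
      ≡⟨ *-distribˡ-sumˡ (fromℕ 2) (subsets n) _ ⟨
    fromℕ 2 * sumˡ (subsets n) (λ S → ⟦ △? v S ⟧)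
      ≡⟨ cong (fromℕ 2 *_) (fromℕ-length-filter (△? v) (subsets n)) ⟨
    fromℕ 2 * fromℕ (△ G v) ∎
    where
    pair : Subset n → Fin n → Fin n → ℚ
    pair S u j = ⟦ u ∈? S - v ⟧ * ⟦ j ∈? S - v - u ⟧

    term : ∀ S → sum (λ u → sum (λ j → ⟦ △? v S ⟧ * pair S u j)) ≡ fromℕ 2 * ⟦ △? v S ⟧
    term S = begin
      sum (λ u → sum (λ j → ⟦ △? v S ⟧ * pair S u j))
        ≡⟨ sum-cong-≗ (λ u → sym (*-distribˡ-sum ⟦ △? v S ⟧ (pair S u))) ⟩
      sum (λ u → ⟦ △? v S ⟧ * sum (pair S u))
        ≡⟨ *-distribˡ-sum ⟦ △? v S ⟧ (λ u → sum (pair S u)) ⟨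
      ⟦ △? v S ⟧ * sum (λ u → sum (pair S u))
        ≡⟨ cong (⟦ △? v S ⟧ *_) (sum-ordered-pairs (S - v)) ⟩
      ⟦ △? v S ⟧ * (fromℕ ∣ S - v ∣ * fromℕ (ℕ.pred ∣ S - v ∣))
        -- For a triangle `S` through `v`, `S - v` has two elements, and `fromℕ 2 * fromℕ 1`
        -- computes to `fromℕ 2`.
        ≡⟨ ⟦⟧*-cong (△? v S) (λ ((∣S∣≡3 , _) , v∈S) →
             cong (λ k → fromℕ k * fromℕ (ℕ.pred k))
               (ℕ.suc-injective (trans (sym (x∈p⇒∣p∣≡1+∣p-x∣ v∈S)) ∣S∣≡3))) ⟩
      ⟦ △? v S ⟧ * fromℕ 2
        ≡⟨ ℚ.*-comm ⟦ △? v S ⟧ (fromℕ 2) ⟩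
      fromℕ 2 * ⟦ △? v S ⟧ ∎

  -- Double counting of incidences: a triangle is counted once at each of its three vertices.
  sum-△≡3△-total : sum (λ v → fromℕ (△ G v)) ≡ fromℕ 3 * fromℕ (△-total G)
  sum-△≡3△-total = begin
    sum (λ v → fromℕ (△ G v))
      ≡⟨ sum-cong-≗ (λ v → fromℕ-length-filter (△? v) (subsets n)) ⟩
    sum (λ v → sumˡ (subsets n) (λ S → ⟦ △? v S ⟧))
      ≡⟨ sum-sumˡ-comm (subsets n) (λ v S → ⟦ △? v S ⟧) ⟩
    sumˡ (subsets n) (λ S → sum (λ v → ⟦ △? v S ⟧))
      ≡⟨ sumˡ-cong (subsets n) term ⟩
    sumˡ (subsets n) (λ S → fromℕ 3 * ⟦ isTriangle? G S ⟧)
      ≡⟨ *-distribˡ-sumˡ (fromℕ 3) (subsets n) _ ⟨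
    fromℕ 3 * sumˡ (subsets n) (λ S → ⟦ isTriangle? G S ⟧)
      ≡⟨ cong (fromℕ 3 *_) (fromℕ-length-filter (isTriangle? G) (subsets n)) ⟨
    fromℕ 3 * fromℕ (△-total G) ∎
    where
    term : ∀ S → sum (λ v → ⟦ △? v S ⟧) ≡ fromℕ 3 * ⟦ isTriangle? G S ⟧
    term S = begin
      sum (λ v → ⟦ △? v S ⟧)
        ≡⟨ sum-cong-≗ (λ v → ⟦⟧-× (isTriangle? G S) (v ∈? S)) ⟩
      sum (λ v → ⟦ isTriangle? G S ⟧ * ⟦ v ∈? S ⟧)
        ≡⟨ *-distribˡ-sum ⟦ isTriangle? G S ⟧ (λ v → ⟦ v ∈? S ⟧) ⟨
      ⟦ isTriangle? G S ⟧ * sum (λ v → ⟦ v ∈? S ⟧)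
        ≡⟨ cong (⟦ isTriangle? G S ⟧ *_) (fromℕ-∣∣ S) ⟨
      ⟦ isTriangle? G S ⟧ * fromℕ ∣ S ∣
        ≡⟨ ⟦⟧*-cong (isTriangle? G S) (cong fromℕ ∘ proj₁) ⟩
      ⟦ isTriangle? G S ⟧ * fromℕ 3
        ≡⟨ ℚ.*-comm ⟦ isTriangle? G S ⟧ (fromℕ 3) ⟩
      fromℕ 3 * ⟦ isTriangle? G S ⟧ ∎

  𝟏T𝟏≡6△-total : 𝟏 ∙ (T G *ᵛ 𝟏) ≡ fromℕ 6 * fromℕ (△-total G)
  𝟏T𝟏≡6△-total = begin
    sum (λ v → 1ℚ * (T G *ᵛ 𝟏) v)            ≡⟨ sum-cong-≗ (λ v → trans (ℚ.*-identityˡ _) (T𝟏≡2△ v)) ⟩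
    sum (λ v → fromℕ 2 * fromℕ (△ G v))      ≡⟨ *-distribˡ-sum (fromℕ 2) (λ v → fromℕ (△ G v)) ⟨
    fromℕ 2 * sum (λ v → fromℕ (△ G v))      ≡⟨ cong (fromℕ 2 *_) sum-△≡3△-total ⟩
    fromℕ 2 * (fromℕ 3 * fromℕ (△-total G))  ≡⟨ ℚ.*-assoc (fromℕ 2) (fromℕ 3) (fromℕ (△-total G)) ⟨
    fromℕ 6 * fromℕ (△-total G)              ∎

  -- Triangle neighborhoods and the support of `T`

  ∈N⇔ : ∀ {v u} → u ∈ N G v ⇔ Adj v u
  ∈N⇔ {v} = ∈-comprehension (adj? v)

  N△-dec : ∀ v → U.Decidable (λ u → u ∈ N G v × Nonempty (N G u ∩ N G v))
  N△-dec v u = (u ∈? N G v) ×-dec nonempty? (N G u ∩ N G v)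

  ∈N△⇔ : ∀ {v u} → u ∈ N△ G v ⇔ (u ∈ N G v × Nonempty (N G u ∩ N G v))
  ∈N△⇔ {v} = ∈-comprehension (N△-dec v)

  N△⊆N : ∀ v → N△ G v ⊆ N G v
  N△⊆N v = proj₁ ∘ Equivalence.to ∈N△⇔

  -- Makes the union defining `N△[ v ]` disjoint, so that indicators add. No vertex is its own
  -- neighbour.
  v∉N△ : ∀ v → Empty (⁅ v ⁆ ∩ N△ G v)
  v∉N△ v (x , x∈) with x∈p∩q⁻ ⁅ v ⁆ (N△ G v) x∈
  ... | x∈⁅v⁆ , x∈N△ = irrefl (sym (x∈⁅y⁆⇒x≡y v x∈⁅v⁆)) (Equivalence.to ∈N⇔ (N△⊆N v x∈N△))

  T≡sum : ∀ v u → T G v u ≡ sum (λ j → ⟦ (adj? v j ×-dec adj? j u) ×-dec adj? v u ⟧)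
  T≡sum v u = trans (*-distribʳ-sum (A G v u) (λ j → A G v j * A G j u)) (sum-cong-≗ (AAA≡⟦⟧ v u))

  -- By `T≡sum` the entry counts the common neighbours `j` of `v` and `u` if these are adjacent, and
  -- is zero otherwise; a nonzero count amounts to a witness `j` in `N u ∩ N v`.
  T≢0⇔∈N△ : ∀ {v u} → T G v u ≢ 0ℚ ⇔ u ∈ N△ G v
  T≢0⇔∈N△ {v} {u} = mk⇔
    (λ T≢0 → let j , (vj , ju) , vu = Equivalence.to sum≢0⇔ (T≢0 ∘ trans (T≡sum v u)) in
      Equivalence.from ∈N△⇔
        (Equivalence.from ∈N⇔ vu , j , x∈p∩q⁺ (Equivalence.from ∈N⇔ (symm ju) , Equivalence.from ∈N⇔ vj)))
    (λ u∈N△ → let u∈N , j , j∈ = Equivalence.to ∈N△⇔ u∈N△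
                  j∈Nu , j∈Nv = x∈p∩q⁻ (N G u) (N G v) j∈ in
      Equivalence.from sum≢0⇔
        (j , (Equivalence.to ∈N⇔ j∈Nv , symm (Equivalence.to ∈N⇔ j∈Nu)) , Equivalence.to ∈N⇔ u∈N)
      ∘ trans (sym (T≡sum v u)))
    where
    sum≢0⇔ = sum-⟦⟧≢0⇔∃ (λ j → (adj? v j ×-dec adj? j u) ×-dec adj? v u)

  Ť≡⟦∈N△⟧ : ∀ v u → Ť G v u ≡ ⟦ u ∈? N△ G v ⟧
  -- `binary` branches on equality with zero, so its value is the indicator of the negated decision.
  Ť≡⟦∈N△⟧ v u = trans (binary≡ (T G v u ℚ.≟ 0ℚ)) (⟦⟧-⇔ T≢0⇔∈N△ (¬? (T G v u ℚ.≟ 0ℚ)) (u ∈? N△ G v))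
    where
    binary≡ : (P? : Dec P) → (if does P? then 0ℚ else 1ℚ) ≡ ⟦ ¬? P? ⟧
    binary≡ (yes _) = refl
    binary≡ (no _)  = refl

  -- The coefficient matrix and the numerator of triangle centrality

  weight : Matrix n n
  weight = fromℕ 3 • A G -ᴹ fromℕ 2 • Ť G +ᴹ I

  -- On `N△ v` the entry is 3 - 2 = 1, at `v` itself only `I` contributes, and on the remaining
  -- neighbours 3 is left.
  weight≡ : ∀ v u → weight v u ≡ ⟦ u ∈? N△[_] G v ⟧ + fromℕ 3 * ⟦ u ∈? N G v ─ N△ G v ⟧
  weight≡ v u = begin
    fromℕ 3 * A G v u ℚ.- fromℕ 2 * Ť G v u + I v u
      ≡⟨ cong₂ (λ a t → fromℕ 3 * a ℚ.- fromℕ 2 * t + I v u)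
           (trans (⟦⟧-⇔ (mk⇔ (Equivalence.from ∈N⇔) (Equivalence.to ∈N⇔)) (adj? v u) (u ∈? N G v)) (⟦∈─⟧ (N△⊆N v) u))
           (Ť≡⟦∈N△⟧ v u) ⟩
    fromℕ 3 * (d + t) ℚ.- fromℕ 2 * t + I v u
      ≡⟨ solve 3 (λ d t i → con (fromℕ 3) :* (d :+ t) :- con (fromℕ 2) :* t :+ i
                         := (i :+ t) :+ con (fromℕ 3) :* d) refl d t (I v u) ⟩
    (I v u + t) + fromℕ 3 * d
      ≡⟨ cong (λ i → (i + t) + fromℕ 3 * d) (⟦∈⁅⁆⟧ v u) ⟨
    (⟦ u ∈? ⁅ v ⁆ ⟧ + t) + fromℕ 3 * d
      ≡⟨ cong (_+ fromℕ 3 * d) (⟦∈∪⟧ ⁅ v ⁆ (N△ G v) (v∉N△ v) u) ⟨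
    ⟦ u ∈? N△[_] G v ⟧ + fromℕ 3 * d ∎
    where
    open +-*-Solver using (solve; _:=_; _:+_; _:*_; _:-_; con)
    d = ⟦ u ∈? N G v ─ N△ G v ⟧
    t = ⟦ u ∈? N△ G v ⟧

  -- Agrees definitionally with the numerator in `TC`, so the final quotient needs no rewriting.
  TC-numerator : Vector ℚ n
  TC-numerator v = (ℤ.+ 1 / 3) * sumOver (N△[_] G v) (λ u → fromℕ (△ G u))
                 + sumOver (N G v ─ N△ G v) (λ w → fromℕ (△ G w))

  -- The factor 6 is the 3 by which `weight` scales the coefficients of `TC`, times the 2 from
  -- `T𝟏≡2△`.
  weight*ᵛT𝟏≡6TC-numerator : ∀ v → (weight *ᴹ T G *ᵛ 𝟏) v ≡ fromℕ 6 * TC-numerator v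
  weight*ᵛT𝟏≡6TC-numerator v = begin
    (weight *ᴹ T G *ᵛ 𝟏) v
      ≡⟨ *ᴹ-*ᵛ-assoc weight (T G) 𝟏 v ⟩
    sum (λ u → weight v u * (T G *ᵛ 𝟏) u)
      ≡⟨ sum-cong-≗ (λ u → trans (cong₂ _*_ (weight≡ v u) (T𝟏≡2△ u))
           (solve 3 (λ c d t → (c :+ con (fromℕ 3) :* d) :* (con (fromℕ 2) :* t)
                             := con (fromℕ 2) :* (c :* t) :+ con (fromℕ 6) :* (d :* t)) refl
             ⟦ u ∈? N△[_] G v ⟧ ⟦ u ∈? N G v ─ N△ G v ⟧ (fromℕ (△ G u)))) ⟩
    sum (λ u → fromℕ 2 * (⟦ u ∈? N△[_] G v ⟧ * fromℕ (△ G u)) + fromℕ 6 * (⟦ u ∈? N G v ─ N△ G v ⟧ * fromℕ (△ G u)))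
      ≡⟨ ∑-distrib-+ (λ u → fromℕ 2 * (⟦ u ∈? N△[_] G v ⟧ * fromℕ (△ G u))) _ ⟩
    sum (λ u → fromℕ 2 * (⟦ u ∈? N△[_] G v ⟧ * fromℕ (△ G u))) +
    sum (λ u → fromℕ 6 * (⟦ u ∈? N G v ─ N△ G v ⟧ * fromℕ (△ G u)))
      ≡⟨ cong₂ _+_ (factor (fromℕ 2) (N△[_] G v)) (factor (fromℕ 6) (N G v ─ N△ G v)) ⟩
    -- The coefficient 2 of the closed triangle neighborhood is 6 times the 1/3 of `TC`.
    fromℕ 2 * x + fromℕ 6 * y
      ≡⟨ solve 2 (λ x y → con (fromℕ 2) :* x :+ con (fromℕ 6) :* y
                        := con (fromℕ 6) :* (con (ℤ.+ 1 / 3) :* x :+ y)) refl x y ⟩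
    fromℕ 6 * TC-numerator v ∎
    where
    open +-*-Solver using (solve; _:=_; _:+_; _:*_; _:-_; con)
    x = sumOver (N△[_] G v) (λ u → fromℕ (△ G u))
    y = sumOver (N G v ─ N△ G v) (λ w → fromℕ (△ G w))
    factor : ∀ c p → sum (λ u → c * (⟦ u ∈? p ⟧ * fromℕ (△ G u))) ≡ c * sumOver p (λ u → fromℕ (△ G u))
    factor c p = begin
      sum (λ u → c * (⟦ u ∈? p ⟧ * fromℕ (△ G u)))  ≡⟨ *-distribˡ-sum c (λ u → ⟦ u ∈? p ⟧ * fromℕ (△ G u)) ⟨
      c * sum (λ u → ⟦ u ∈? p ⟧ * fromℕ (△ G u))    ≡⟨ cong (c *_) (sum-cong-≗ (λ u → if≡⟦⟧* (u ∈? p) (fromℕ (△ G u)))) ⟨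
      c * sumOver p (λ u → fromℕ (△ G u))           ∎

proposition2 : ∀ {n : ℕ} (G : Graph n) .{{_ : ℕ.NonZero (△-total G)}} →
    Σ[ nz ∈ NonZero (𝟏 ∙ (T G *ᵛ 𝟏)) ]
    TC G ≗ _÷ᵛ_ ((fromℕ 3 • A G -ᴹ fromℕ 2 • Ť G +ᴹ I) *ᴹ T G *ᵛ 𝟏) (𝟏 ∙ (T G *ᵛ 𝟏)) {{nz}}
-- Numerator and denominator of the matrix formula are both 6 times those of `TC`, so
-- cross-multiplication closes the goal.
proposition2 G = nz , λ v → x÷y≡z÷w
  (TC-numerator G v) t ((weight G *ᴹ T G *ᵛ 𝟏) v) (𝟏 ∙ (T G *ᵛ 𝟏)) {{ℚ.pos⇒nonZero t}} {{nz}} (begin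
  TC-numerator G v * (𝟏 ∙ (T G *ᵛ 𝟏))     ≡⟨ cong (TC-numerator G v *_) (𝟏T𝟏≡6△-total G) ⟩
  TC-numerator G v * (fromℕ 6 * t)        ≡⟨ ℚ.*-assoc (TC-numerator G v) (fromℕ 6) t ⟨
  TC-numerator G v * fromℕ 6 * t          ≡⟨ cong (_* t) (ℚ.*-comm (TC-numerator G v) (fromℕ 6)) ⟩
  fromℕ 6 * TC-numerator G v * t          ≡⟨ cong (_* t) (weight*ᵛT𝟏≡6TC-numerator G v) ⟨
  (weight G *ᴹ T G *ᵛ 𝟏) v * t            ∎)
  where
  t = fromℕ (△-total G)
  instance
    t-pos : Positive t
    t-pos = ℚ.normalize-pos (△-total G) 1
  nz : NonZero (𝟏 ∙ (T G *ᵛ 𝟏))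
  -- The denominator is 6 times the number of triangles, which is positive by hypothesis.
  nz = subst NonZero (sym (𝟏T𝟏≡6△-total G))
    (ℚ.pos⇒nonZero (fromℕ 6 * t) {{ℚ.pos*pos⇒pos (fromℕ 6) t}})
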